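{- There is an absolute constant $c>0$ such that for all integers $n\ge 2$, $q\ge 1$, $m\ge1$ and every antichain $A=\{\alpha_0,\ldots,\alpha_{n-1}\}\subset\{0,1\}^m$ of cardinality $n$, $$L(S_{q,A}) \ge q n\log_2 n - c\, q n .$$
   Context: $L(F)$ denotes the minimal number of gates in a circuit over the basis $\{\vee,\wedge\}$ (binary disjunction and conjunction gates, inputs being the variables) computing the (possibly partially defined) boolean operator $F$; a circuit computes a partially defined operator if its outputs agree with $F$ on every input where $F$ is defined. Let $X=(x_0,\ldots,x_{n-1})$ with $x_i=(x_{i,0},\ldots,x_{i,q-1})^T$ be a $q\times n$ matrix of boolean variables, and $Y=(y_0,\ldots,y_{m-1})$ a vector of boolean variables. For a sequence $v=(v_0,\ldots,v_{n-1})$, $v\gg k$ denotes its cyclic shift by $k$ positions to the right, i.e. the sequence whose entry at position $(j+k)\bmod n$ is $v_j$. The monotone cyclic shift operator $S_{q,A}(X,Y)=(s_0,\ldots,s_{n-1})$ is the partially defined operator defined only for $Y\in A$, with $S_{q,A}(X,\alpha_k)=X\gg k$ for $k=0,\ldots,n-1$ and all $X\in\{0,1\}^{q\times n}$. -}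

module Defs where

open import Data.Nat using (ℕ; zero; suc; _+_; _*_)
open import Data.Nat.DivMod using (_mod_)
open import Data.Bool using (Bool; _∨_; _∧_) renaming (_≤_ to _≤ᵇ_)
open import Data.Fin using (Fin; zero; suc; toℕ; splitAt; remQuot)
open import Data.Sum using ([_,_])
open import Data.Product using (_,_)
open import Relation.Binary.PropositionalEquality using (_≡_; _≢_)
open import Relation.Nullary using (¬_)

data Op : Set where
  OR AND : Op

apply : Op → Bool → Bool → Bool
apply OR  a b = a ∨ b
apply AND a b = a ∧ b

-- A straight-line {∨,∧}-circuit over N input variables with s gates.
-- Nodes are indexed by Fin (s + N): index zero is the most recent gate,
-- the inputs are the last N indices.  Each gate reads two earlier nodes.
data Straight (N : ℕ) : ℕ → Set where
  inputs : Straight N 0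
  gate   : ∀ {s} → Straight N s → Op → Fin (s + N) → Fin (s + N) → Straight N (suc s)

eval : ∀ {N s} → Straight N s → (Fin N → Bool) → Fin (s + N) → Bool
eval inputs         x k       = x k
eval (gate c o i j) x zero    = apply o (eval c x i) (eval c x j)
eval (gate c o i j) x (suc k) = eval c x k

-- Input variables: the q×n matrix X (x_{r,j}, row r, column j) followed by Y.
NumInputs : ℕ → ℕ → ℕ → ℕ
NumInputs q n m = q * n + m

env : ∀ {q n m} → (Fin q → Fin n → Bool) → (Fin m → Bool) → Fin (NumInputs q n m) → Bool
env {q} {n} X Y i =
  [ (λ a → let (r , j) = remQuot {q} n a in X r j) , Y ] (splitAt (q * n) i)

record MCircuit (q n m s : ℕ) : Set where
  field
    body : Straight (NumInputs q n m) s
    out  : Fin q → Fin n → Fin (s + NumInputs q n m)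

-- (j + k) mod n, the position that v_j moves to in v ≫ k.
addMod : ∀ {n} → Fin n → Fin n → Fin n
addMod {suc n} j k = (toℕ j + toℕ k) mod (suc n)

Computes : ∀ {q n m s} → MCircuit q n m s → (Fin n → Fin m → Bool) → Set
Computes {q} {n} {m} C α =
  ∀ (k : Fin n) (X : Fin q → Fin n → Bool) (r : Fin q) (j : Fin n) →
    eval (MCircuit.body C) (env X (α k)) (MCircuit.out C r (addMod j k)) ≡ X r j

-- α : Fin n → {0,1}^m lists an antichain of n (distinct) vectors, ordered
-- componentwise.  (Pairwise incomparability for distinct indices also forces
-- the α i to be pairwise distinct, so the set has cardinality exactly n.)
IsAntichain : ∀ {n m} → (Fin n → Fin m → Bool) → Set
IsAntichain {n} {m} α =
  ∀ (i j : Fin n) → i ≢ j → ¬ (∀ (t : Fin m) → α i t ≤ᵇ α j t)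

{-# OPTIONS --safe #-}
-- Fix the shift k.  An output that copies the variable x_i is 1 at the i-th unit
-- matrix and 0 at its complement.  A gate with this property has a predecessor with it,
-- so such gates contain a path from that output to x_i.  By monotonicity no gate
-- has the property for two different variables, so the paths of different outputs share
-- no gate and their total length is at most s.
--
-- Fix an output instead.  The n shifts give paths to n different inputs, and Kraft's
-- inequality for the binary unfolding of the circuit makes their average length at
-- least ⌊log₂ n⌋.  Comparing both bounds over all outputs and shifts gives
-- q n ⌊log₂ n⌋ ≤ s.
module Submission where

open import Defs
open import Data.Nat using (ℕ; zero; suc; _+_; _*_; _^_; _∸_; _≤_; _<_; z≤n; s≤s; NonZero; >-nonZero)
open import Data.Nat.Properties
open import Data.Nat.DivMod
  using (_%_; _mod_; %-distribˡ-+; m%n%n≡m%n; [m+n]%n≡m%n; m<n⇒m%n≡m; m%n<n)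
open import Data.Fin using (Fin; zero; suc; toℕ; splitAt; remQuot)
open import Data.Fin.Properties
  using (toℕ-fromℕ<; toℕ-injective; toℕ<n; toℕ≤n; *↔×) renaming (_≟_ to _≟ᶠ_)
open import Data.Bool using (Bool; true; false; not; _∧_; if_then_else_)
import Data.Bool.Properties as Bool
open import Data.Product using (Σ; _×_; _,_; proj₁; proj₂; uncurry)
open import Data.Product.Properties using (,-injectiveʳ)
open import Data.Sum using (_⊎_; inj₁; inj₂) renaming (map to map⊎)
open import Data.Sum.Properties using (inj₁-injective)
open import Function using (_∘_; id)
open import Function.Bundles using (module Inverse)
open import Relation.Binary.PropositionalEquality
open import Relation.Nullary using (Dec; yes; no; does; contradiction)
open import Algebra.Properties.CommutativeMonoid.Sum +-0-commutativeMonoid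
  using (sum; ∑-distrib-+; ∑-comm; sum-cong-≗)

-- Sums of naturals over finite index sets.

sum-mono : ∀ {n} {f g : Fin n → ℕ} → (∀ i → f i ≤ g i) → sum f ≤ sum g
sum-mono {zero}  f≤g = z≤n
sum-mono {suc n} f≤g = +-mono-≤ (f≤g zero) (sum-mono (f≤g ∘ suc))

sum-upper : ∀ {n b} {f : Fin n → ℕ} → (∀ i → f i ≤ b) → sum f ≤ n * b
sum-upper {zero}  f≤b = z≤n
sum-upper {suc n} f≤b = +-mono-≤ (f≤b zero) (sum-upper (f≤b ∘ suc))

sum-lower : ∀ {n b} {f : Fin n → ℕ} → (∀ i → b ≤ f i) → n * b ≤ sum f
sum-lower {zero}  b≤f = z≤n
sum-lower {suc n} b≤f = +-mono-≤ (b≤f zero) (sum-lower (b≤f ∘ suc))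

sum-zero : ∀ {n} (f : Fin n → ℕ) → (∀ i → f i ≤ 0) → sum f ≤ 0
sum-zero {n} f f≤0 = subst (sum f ≤_) (*-zeroʳ n) (sum-upper f≤0)

-- Serves twice: a gate starts at most one of the disjoint paths, and an input variable is separated
-- for at most one shift.
sum-subsingleton : ∀ {n b} (f : Fin n → ℕ) →
  (∀ i j → f i ≢ 0 → f j ≢ 0 → i ≡ j) → (∀ i → f i ≤ b) → sum f ≤ b
sum-subsingleton {zero}  f uniq f≤b = z≤n
sum-subsingleton {suc n} f uniq f≤b with f zero ≟ 0
... | yes f₀≡0 rewrite f₀≡0 =
  sum-subsingleton (f ∘ suc) (λ i j p q → suc-inj (uniq (suc i) (suc j) p q)) (f≤b ∘ suc)
  where
  suc-inj : ∀ {m} {i j : Fin m} → Fin.suc i ≡ suc j → i ≡ j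
  suc-inj refl = refl
... | no f₀≢0 = ≤-trans (+-mono-≤ (f≤b zero) (sum-zero (f ∘ suc) rest)) (≤-reflexive (+-identityʳ _))
  where
  rest : ∀ i → f (suc i) ≤ 0
  rest i with f (suc i) ≟ 0
  ... | yes e = ≤-reflexive e
  ... | no ≢0 = contradiction (uniq zero (suc i) f₀≢0 ≢0) λ ()

-- Separated nodes and the paths they form.

Separates : ∀ {N s} → Straight N s → (x y : Fin N → Bool) → Fin (s + N) → Set
Separates c x y v = eval c x v ≡ true × eval c y v ≡ false

true,false? : ∀ a b → Dec (a ≡ true × b ≡ false)
true,false? true  false = yes (refl , refl)
true,false? true  true  = no λ ()
true,false? false b     = no λ ()

separates? : ∀ {N s} (c : Straight N s) x y v → Dec (Separates c x y v)
separates? c x y v = true,false? (eval c x v) (eval c y v)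

-- For `OR` both primed arguments are `false` while some unprimed one is `true`, so that one falls;
-- `AND` is dual.
apply-separates : ∀ o a b {a′ b′} → apply o a b ≡ true → apply o a′ b′ ≡ false →
  (a ≡ true × a′ ≡ false) ⊎ (b ≡ true × b′ ≡ false)
apply-separates OR  true  b {false}         p q = inj₁ (refl , refl)
apply-separates OR  false b {false}         p q = inj₂ (p , q)
apply-separates AND true  true {false}      p q = inj₁ (refl , refl)
apply-separates AND true  true {true}       p q = inj₂ (refl , q)

apply-mono : ∀ o {a b a′ b′} → (a ≡ true → a′ ≡ true) → (b ≡ true → b′ ≡ true) →
  apply o a b ≡ true → apply o a′ b′ ≡ true
apply-mono OR  {true}         f g p rewrite f refl = refl
apply-mono OR  {false} {true} {a′} f g p rewrite g refl = Bool.∨-zeroʳ a′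
apply-mono AND {true}  {true} f g p rewrite f refl | g refl = refl

eval-mono : ∀ {N s} (c : Straight N s) {x y} → (∀ a → x a ≡ true → y a ≡ true) →
  ∀ v → eval c x v ≡ true → eval c y v ≡ true
eval-mono inputs         x≤y v       = x≤y v
eval-mono (gate c o i j) x≤y zero    = apply-mono o (eval-mono c x≤y i) (eval-mono c x≤y j)
eval-mono (gate c o i j) x≤y (suc v) = eval-mono c x≤y v

-- `j` is a safe default: if the gate is separated and `i` is not, then `j` is. A fixed rule makes
-- the path a function of the pair `x`, `y`.
route : ∀ {N s} → Straight N s → (x y : Fin N → Bool) → (i j : Fin (s + N)) → Fin (s + N)
route c x y i j = if does (separates? c x y i) then i else j

route-separates : ∀ {N s} (c : Straight N s) o i j x y →
  Separates (gate c o i j) x y zero → Separates c x y (route c x y i j)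
route-separates c o i j x y (p , q) with separates? c x y i
... | yes sep = sep
... | no ¬sep with apply-separates o (eval c x i) (eval c x j) p q
...   | inj₁ sep = contradiction sep ¬sep
...   | inj₂ sep = sep

-- Counts the gates met when following `route` to an input; `suc v` only skips a newer gate and adds
-- nothing.
len : ∀ {N s} → Straight N s → (x y : Fin N → Bool) → Fin (s + N) → ℕ
len inputs         x y v       = 0
len (gate c o i j) x y zero    = suc (len c x y (route c x y i j))
len (gate c o i j) x y (suc v) = len c x y v

-- Supports induction on the circuit: the top gate is deleted, and a path starting there moves to
-- its next node.
down : ∀ {N s} → Straight N s → (x y : Fin N → Bool) → (i j : Fin (s + N)) →
  Fin (suc s + N) → Fin (s + N)
down c x y i j zero    = route c x y i j
down c x y i j (suc v) = v

down-separates : ∀ {N s} (c : Straight N s) o i j x y v →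
  Separates (gate c o i j) x y v → Separates c x y (down c x y i j v)
down-separates c o i j x y zero    = route-separates c o i j x y
down-separates c o i j x y (suc v) = id

isTop : ∀ {n} → Fin (suc n) → ℕ
isTop zero    = 1
isTop (suc _) = 0

isTop≤1 : ∀ {n} (v : Fin (suc n)) → isTop v ≤ 1
isTop≤1 zero    = s≤s z≤n
isTop≤1 (suc _) = z≤n

isTop≢0 : ∀ {n} (v : Fin (suc n)) → isTop v ≢ 0 → v ≡ zero
isTop≢0 zero    _  = refl
isTop≢0 (suc _) ≢0 = contradiction refl ≢0

len-down : ∀ {N s} (c : Straight N s) o i j x y v →
  len (gate c o i j) x y v ≡ isTop v + len c x y (down c x y i j v)
len-down c o i j x y zero    = refl
len-down c o i j x y (suc v) = refl

-- Disjointness of the paths.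

-- Contrapositive form of `x p ≤ y p′` for `p ≢ p′`, as for a unit matrix against the complement of
-- another one.
Cross : ∀ {N P} → (x y : Fin P → Fin N → Bool) → Set
Cross x y = ∀ p p′ a → x p a ≡ true → y p′ a ≡ false → p ≡ p′

cross-eval : ∀ {N s P} (c : Straight N s) {x y : Fin P → Fin N → Bool} → Cross x y →
  ∀ p p′ v → eval c (x p) v ≡ true → eval c (y p′) v ≡ false → p ≡ p′
cross-eval c {x} {y} cross p p′ v t f with p ≟ᶠ p′
... | yes e = e
... | no p≢p′ = contradiction (trans (sym (eval-mono c x≤y v t)) f) λ ()
  where
  x≤y : ∀ a → x p a ≡ true → y p′ a ≡ true
  x≤y a e with y p′ a in eq
  ... | true  = refl
  ... | false = contradiction (cross p p′ a e eq) p≢p′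

-- Deleting the top gate shortens only paths that start there. By `cross-eval` there is at most one,
-- so each gate adds at most 1 to the total.
disjoint-paths : ∀ {N s P} (c : Straight N s) (x y : Fin P → Fin N → Bool) → Cross x y →
  (v : Fin P → Fin (s + N)) → (∀ p → Separates c (x p) (y p) (v p)) →
  sum (λ p → len c (x p) (y p) (v p)) ≤ s
disjoint-paths inputs x y cross v sep = sum-zero (λ p → len inputs (x p) (y p) (v p)) (λ _ → z≤n)
disjoint-paths {s = suc s} (gate c o i j) x y cross v sep = begin
  sum (λ p → len (gate c o i j) (x p) (y p) (v p))
    ≡⟨ sum-cong-≗ (λ p → len-down c o i j (x p) (y p) (v p)) ⟩
  sum (λ p → isTop (v p) + len c (x p) (y p) (v′ p))
    ≡⟨ ∑-distrib-+ (isTop ∘ v) (λ p → len c (x p) (y p) (v′ p)) ⟩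
  sum (isTop ∘ v) + sum (λ p → len c (x p) (y p) (v′ p))
    ≤⟨ +-mono-≤ (sum-subsingleton (isTop ∘ v) topUnique (isTop≤1 ∘ v))
         (disjoint-paths c x y cross v′ λ p → down-separates c o i j (x p) (y p) (v p) (sep p)) ⟩
  suc s ∎
  where
  open ≤-Reasoning
  v′ = λ p → down c (x p) (y p) i j (v p)
  topUnique : ∀ p p′ → isTop (v p) ≢ 0 → isTop (v p′) ≢ 0 → p ≡ p′
  topUnique p p′ t t′ = cross-eval (gate c o i j) cross p p′ zero
    (subst (λ u → eval (gate c o i j) (x p) u ≡ true) (isTop≢0 _ t) (proj₁ (sep p)))
    (subst (λ u → eval (gate c o i j) (y p′) u ≡ false) (isTop≢0 _ t′) (proj₂ (sep p′)))

-- Kraft's inequality and the average path length.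

-- 2^(L ∸ l) if l ≤ L, and 0 otherwise: a truncated Kraft weight, scaled by 2^L.
weight : ℕ → ℕ → ℕ
weight L       zero    = 2 ^ L
weight zero    (suc l) = 0
weight (suc L) (suc l) = weight L l

n<2^n : ∀ n → n < 2 ^ n
n<2^n zero    = s≤s z≤n
n<2^n (suc n) = +-mono-≤ (m^n>0 2 n) (≤-trans (n<2^n n) (m≤m+n _ 0))

-- For `l ≤ L` this is `n < 2 ^ n` at `L ∸ l`. The linear bound replaces convexity when Kraft's
-- inequality is turned into a bound on the average.
L<l+weight : ∀ L l → L < l + weight L l
L<l+weight L       zero    = n<2^n L
L<l+weight zero    (suc l) = s≤s z≤n
L<l+weight (suc L) (suc l) = s≤s (L<l+weight L l)

load : ∀ {N s} → ℕ → Straight N s → (x y : Fin N → Bool) → Fin (s + N) → ℕ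
load L c x y v = if does (separates? c x y v) then weight L (len c x y v) else 0

L<len+load : ∀ {N s} L (c : Straight N s) x y v → Separates c x y v →
  L < len c x y v + load L c x y v
L<len+load L c x y v sep with separates? c x y v
... | yes _   = L<l+weight L (len c x y v)
... | no ¬sep = contradiction sep ¬sep

load-input : ∀ {N} L (x y : Fin N → Bool) a → load L inputs x y a ≤ 2 ^ L
load-input L x y a with separates? inputs x y a
... | yes _ = ≤-refl
... | no  _ = z≤n

load≢0 : ∀ {N s} L (c : Straight N s) x y v → load L c x y v ≢ 0 → Separates c x y v
load≢0 L c x y v ≢0 with separates? c x y v
... | yes sep = sep
... | no  _   = contradiction refl ≢0

load-gate-zero : ∀ {N s} (c : Straight N s) o i j x y → load 0 (gate c o i j) x y zero ≤ 0
load-gate-zero c o i j x y with separates? (gate c o i j) x y zero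
... | yes _ = z≤n
... | no  _ = z≤n

-- The path continues through one argument with one gate fewer, and `weight (suc L) (suc l)` is
-- `weight L l`, so the load of that argument already suffices.
load-gate-suc : ∀ {N s} L (c : Straight N s) o i j x y →
  load (suc L) (gate c o i j) x y zero ≤ load L c x y i + load L c x y j
load-gate-suc L c o i j x y with separates? (gate c o i j) x y zero
... | no  _   = z≤n
... | yes (p , q) with separates? c x y i | separates? c x y j
...   | yes _  | _     = m≤m+n _ _
...   | no  _  | yes _ = ≤-refl
...   | no ¬i  | no ¬j with apply-separates o (eval c x i) (eval c x j) p q
...     | inj₁ sep = contradiction sep ¬i
...     | inj₂ sep = contradiction sep ¬j

-- Each gate splits the budget `2 ^ suc L` evenly between its arguments, as in the binary unfolding;
-- at an input at most one index has nonzero load.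
kraft : ∀ {N s K} L (c : Straight N s) (x y : Fin K → Fin N → Bool) →
  (∀ k k′ a → Separates inputs (x k) (y k) a → Separates inputs (x k′) (y k′) a → k ≡ k′) →
  ∀ v → sum (λ k → load L c (x k) (y k) v) ≤ 2 ^ L
kraft L inputs x y uniq v = sum-subsingleton _
  (λ k k′ p p′ → uniq k k′ v (load≢0 L inputs (x k) (y k) v p) (load≢0 L inputs (x k′) (y k′) v p′))
  (λ k → load-input L (x k) (y k) v)
-- A path from a gate has length at least 1, so its weight at `L = 0` vanishes.
kraft zero (gate c o i j) x y uniq zero =
  ≤-trans (sum-zero _ (λ k → load-gate-zero c o i j (x k) (y k))) z≤n
kraft (suc L) (gate c o i j) x y uniq zero = begin
  sum (λ k → load (suc L) (gate c o i j) (x k) (y k) zero)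
    ≤⟨ sum-mono (λ k → load-gate-suc L c o i j (x k) (y k)) ⟩
  sum (λ k → load L c (x k) (y k) i + load L c (x k) (y k) j)
    ≡⟨ ∑-distrib-+ (λ k → load L c (x k) (y k) i) (λ k → load L c (x k) (y k) j) ⟩
  sum (λ k → load L c (x k) (y k) i) + sum (λ k → load L c (x k) (y k) j)
    ≤⟨ +-mono-≤ (kraft L c x y uniq i) (kraft L c x y uniq j) ⟩
  2 ^ L + 2 ^ L
    ≡⟨ cong (2 ^ L +_) (+-identityʳ (2 ^ L)) ⟨
  2 ^ suc L ∎
  where open ≤-Reasoning
kraft L (gate c o i j) x y uniq (suc v) = kraft L c x y uniq v

-- Sum `suc L ≤ len + load` over the `K` pairs: the total load is at most `2 ^ L ≤ K` and cancels
-- against the extra `K` in `K * suc L`.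
average-length : ∀ {N s K} L (c : Straight N s) (x y : Fin K → Fin N → Bool) → 2 ^ L ≤ K →
  (∀ k k′ a → Separates inputs (x k) (y k) a → Separates inputs (x k′) (y k′) a → k ≡ k′) →
  ∀ v → (∀ k → Separates c (x k) (y k) v) → K * L ≤ sum (λ k → len c (x k) (y k) v)
average-length {K = K} L c x y 2^L≤K uniq v sep = +-cancelˡ-≤ K _ _ (begin
  K + K * L
    ≡⟨ *-suc K L ⟨
  K * suc L
    ≤⟨ sum-lower (λ k → L<len+load L c (x k) (y k) v (sep k)) ⟩
  sum (λ k → len c (x k) (y k) v + load L c (x k) (y k) v)
    ≡⟨ ∑-distrib-+ (λ k → len c (x k) (y k) v) (λ k → load L c (x k) (y k) v) ⟩
  sum (λ k → len c (x k) (y k) v) + sum (λ k → load L c (x k) (y k) v)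
    ≤⟨ +-monoʳ-≤ _ (≤-trans (kraft L c x y uniq v) 2^L≤K) ⟩
  sum (λ k → len c (x k) (y k) v) + K
    ≡⟨ +-comm _ K ⟩
  K + sum (λ k → len c (x k) (y k) v) ∎)
  where open ≤-Reasoning

-- Arithmetic of cyclic shifts.

toℕ-mod : ∀ a n .{{_ : NonZero n}} → toℕ (a mod n) ≡ a % n
toℕ-mod a n = toℕ-fromℕ< (m%n<n a n)

[m%n+o]%n : ∀ m o n .{{_ : NonZero n}} → (m % n + o) % n ≡ (m + o) % n
[m%n+o]%n m o n = begin
  (m % n + o) % n             ≡⟨ %-distribˡ-+ (m % n) o n ⟩
  (m % n % n + o % n) % n     ≡⟨ cong (λ u → (u + o % n) % n) (m%n%n≡m%n m n) ⟩
  (m % n + o % n) % n         ≡⟨ %-distribˡ-+ m o n ⟨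
  (m + o) % n                 ∎
  where open ≡-Reasoning

-- Subtraction is encoded as adding a complement, so both cancellation laws below arrive at `t` plus
-- one full turn `suc n`.
mod-cancel : ∀ {n} a b (t : Fin (suc n)) → a + b ≡ toℕ t + suc n →
  (toℕ (a mod suc n) + b) mod suc n ≡ t
mod-cancel {n} a b t e = toℕ-injective (begin
  toℕ ((toℕ (a mod suc n) + b) mod suc n)  ≡⟨ toℕ-mod (toℕ (a mod suc n) + b) (suc n) ⟩
  (toℕ (a mod suc n) + b) % suc n          ≡⟨ cong (λ u → (u + b) % suc n) (toℕ-mod a (suc n)) ⟩
  (a % suc n + b) % suc n                  ≡⟨ [m%n+o]%n a b (suc n) ⟩
  (a + b) % suc n                          ≡⟨ cong (_% suc n) e ⟩
  (toℕ t + suc n) % suc n                  ≡⟨ [m+n]%n≡m%n (toℕ t) (suc n) ⟩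
  toℕ t % suc n                            ≡⟨ m<n⇒m%n≡m (toℕ<n t) ⟩
  toℕ t                                    ∎)
  where open ≡-Reasoning

-- The column that a shift by `k` brings to `t`; `suc n ∸ toℕ k` is never truncated because `k` is
-- in range.
subMod : ∀ {n} → Fin n → Fin n → Fin n
subMod {suc n} t k = (toℕ t + (suc n ∸ toℕ k)) mod suc n

addMod-subMod : ∀ {n} (t k : Fin n) → addMod (subMod t k) k ≡ t
addMod-subMod {suc n} t k = mod-cancel (toℕ t + (suc n ∸ toℕ k)) (toℕ k) t
  (trans (+-assoc (toℕ t) _ _) (cong (toℕ t +_) (m∸n+n≡m (toℕ≤n k))))

subMod-addMod : ∀ {n} (j k : Fin n) → subMod (addMod j k) j ≡ k
subMod-addMod {suc n} j k = mod-cancel (toℕ j + toℕ k) (suc n ∸ toℕ j) k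
  (trans (cong (_+ (suc n ∸ toℕ j)) (+-comm (toℕ j) (toℕ k)))
  (trans (+-assoc (toℕ k) _ _) (cong (toℕ k +_) (m+[n∸m]≡n (toℕ≤n j)))))

subMod-involutive : ∀ {n} (t k : Fin n) → subMod t (subMod t k) ≡ k
subMod-involutive t k =
  trans (cong (λ u → subMod u (subMod t k)) (sym (addMod-subMod t k))) (subMod-addMod (subMod t k) k)

subMod-injectiveʳ : ∀ {n} (t k k′ : Fin n) → subMod t k ≡ subMod t k′ → k ≡ k′
subMod-injectiveʳ t k k′ e =
  trans (sym (subMod-involutive t k)) (trans (cong (subMod t) e) (subMod-involutive t k′))

subMod-injectiveˡ : ∀ {n} (k t t′ : Fin n) → subMod t k ≡ subMod t′ k → t ≡ t′
subMod-injectiveˡ k t t′ e =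
  trans (sym (addMod-subMod t k)) (trans (cong (λ u → addMod u k) e) (addMod-subMod t′ k))

-- Test matrices and the inputs they separate.

module _ {q n : ℕ} where

  unit : Fin q × Fin n → Fin q → Fin n → Bool
  unit (r , j) r′ j′ = does (r ≟ᶠ r′) ∧ does (j ≟ᶠ j′)

  counit : Fin q × Fin n → Fin q → Fin n → Bool
  counit e r′ j′ = not (unit e r′ j′)

  unit-diag : ∀ e → uncurry (unit e) e ≡ true
  unit-diag (r , j) with r ≟ᶠ r | j ≟ᶠ j
  ... | yes _  | yes _  = refl
  ... | no r≢r | _      = contradiction refl r≢r
  ... | yes _  | no j≢j = contradiction refl j≢j

  unit-support : ∀ e e′ → uncurry (unit e) e′ ≡ true → e′ ≡ e
  unit-support (r , j) (r′ , j′) p with r ≟ᶠ r′ | j ≟ᶠ j′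
  unit-support _ _ p | yes refl | yes refl = refl

  module _ {m : ℕ} where

    entry : Fin (NumInputs q n m) → (Fin q × Fin n) ⊎ Fin m
    entry a = map⊎ (remQuot {q} n) id (splitAt (q * n) a)

    -- The bits of `Y` agree in both environments, so only a matrix entry can separate them: it is
    -- the 1 of `unit e` and the 0 of `counit e′`.
    env-separates : ∀ Y e e′ a → env (unit e) Y a ≡ true → env (counit e′) Y a ≡ false →
      entry a ≡ inj₁ e × entry a ≡ inj₁ e′
    env-separates Y e e′ a p p′ with splitAt (q * n) a
    ... | inj₁ b = cong inj₁ (unit-support e _ p) , cong inj₁ (unit-support e′ _ (Bool.not-injective p′))
    ... | inj₂ b = contradiction (trans (sym p) p′) λ ()

remQuot-injective : ∀ {q} n (p p′ : Fin (q * n)) → remQuot {q} n p ≡ remQuot {q} n p′ → p ≡ p′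
remQuot-injective {q} n p p′ e =
  trans (sym (strictlyInverseʳ p)) (trans (cong from e) (strictlyInverseʳ p′))
  where open Inverse (*↔× {q} {n})

-- Double counting over outputs and shifts.

shift-bound : ∀ {q n m s} (α : Fin n → Fin m → Bool) (C : MCircuit q n m s) → Computes C α →
  .{{NonZero n}} → ∀ L → 2 ^ L ≤ n → q * n * L ≤ s
-- `length p k` is summed in both orders; the common factor `n`, the number of shifts, then cancels.
shift-bound {q} {n} {m} {s} α C comp L 2^L≤n = *-cancelˡ-≤ n (begin
  n * (q * n * L)                       ≡⟨ *-comm n (q * n * L) ⟩
  q * n * L * n                         ≡⟨ *-assoc (q * n) L n ⟩
  q * n * (L * n)                       ≡⟨ cong (q * n *_) (*-comm L n) ⟩
  q * n * (n * L)                       ≤⟨ sum-lower long ⟩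
  sum (λ p → sum (λ k → length p k))    ≡⟨ ∑-comm length ⟩
  sum (λ k → sum (λ p → length p k))    ≤⟨ sum-upper short ⟩
  n * s                                 ∎)
  where
  open ≤-Reasoning
  open MCircuit C

  Row : Fin (q * n) → Fin q
  Row p = proj₁ (remQuot {q} n p)

  Col : Fin (q * n) → Fin n
  Col p = proj₂ (remQuot {q} n p)

  source : Fin (q * n) → Fin n → Fin q × Fin n
  source p k = Row p , subMod (Col p) k

  target : Fin (q * n) → Fin (s + NumInputs q n m)
  target p = out (Row p) (Col p)

  x y : Fin (q * n) → Fin n → Fin (NumInputs q n m) → Bool
  x p k = env (unit (source p k)) (α k)
  y p k = env (counit (source p k)) (α k)

  length : Fin (q * n) → Fin n → ℕ
  length p k = len body (x p k) (y p k) (target p)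

  copies : ∀ p k (X : Fin q → Fin n → Bool) → eval body (env X (α k)) (target p) ≡ uncurry X (source p k)
  -- `comp` speaks of columns `addMod j k`; the choice `j = subMod (Col p) k` reaches the column of
  -- `p`.
  copies p k X = subst (λ t → eval body (env X (α k)) (out (Row p) t) ≡ uncurry X (source p k))
    (addMod-subMod (Col p) k) (comp k X (Row p) (subMod (Col p) k))

  separated : ∀ p k → Separates body (x p k) (y p k) (target p)
  separated p k =
    trans (copies p k (unit (source p k))) (unit-diag (source p k)) ,
    trans (copies p k (counit (source p k))) (cong not (unit-diag (source p k)))

  long : ∀ p → n * L ≤ sum (λ k → length p k)
  -- Fixed output: different shifts have different source columns, so each input is separated for at
  -- most one shift.
  long p = average-length L body (x p) (y p) 2^L≤n unique (target p) (separated p)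
    where
    unique : ∀ k k′ a → Separates inputs (x p k) (y p k) a → Separates inputs (x p k′) (y p k′) a → k ≡ k′
    unique k k′ a (t , f) (t′ , f′) = subMod-injectiveʳ (Col p) k k′ (,-injectiveʳ (inj₁-injective
      (trans (sym (proj₁ (env-separates (α k) (source p k) (source p k) a t f)))
             (proj₁ (env-separates (α k′) (source p k′) (source p k′) a t′ f′)))))

  short : ∀ k → sum (λ p → length p k) ≤ s
  -- Fixed shift: translation of columns is injective, so distinct outputs copy distinct entries.
  short k = disjoint-paths body (λ p → x p k) (λ p → y p k) cross target (λ p → separated p k)
    where
    cross : Cross (λ p → x p k) (λ p → y p k)
    cross p p′ a t f with env-separates (α k) (source p k) (source p′ k) a t f
    ... | e , e′ with inj₁-injective (trans (sym e) e′)
    ...   | eq = remQuot-injective {q} n p p′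
      (cong₂ _,_ (cong proj₁ eq) (subMod-injectiveˡ k (Col p) (Col p′) (,-injectiveʳ eq)))

-- `L` is the binary logarithm rounded down; in the induction it grows exactly when the new number
-- equals `2 ^ suc L`.
binary-scale : ∀ n → .{{NonZero n}} → Σ ℕ λ L → 2 ^ L ≤ n × n < 2 ^ suc L
binary-scale (suc zero) = 0 , s≤s z≤n , s≤s (s≤s z≤n)
binary-scale (suc (suc n)) with binary-scale (suc n)
... | L , lo , hi with m≤n⇒m<n∨m≡n hi
...   | inj₁ lt = L , m≤n⇒m≤1+n lo , lt
...   | inj₂ eq = suc L , ≤-reflexive (sym eq) ,
        subst (_< 2 ^ suc (suc L)) (sym eq) (^-monoʳ-< 2 (s≤s (s≤s z≤n)) (n<1+n (suc L)))

theorem3 : Σ ℕ (λ c → 1 ≤ c × ((n q m : ℕ) → 2 ≤ n → 1 ≤ q → 1 ≤ m →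
    (α : Fin n → Fin m → Bool) → IsAntichain α →
    (s : ℕ) (C : MCircuit q n m s) → Computes C α →
    n ^ (q * n) ≤ 2 ^ (s + c * q * n)))
-- The constant 1 pays for the rounding: `log₂ n < L + 1`, so `q n log₂ n` exceeds `q n L ≤ s` by at
-- most `q n`. Exponentiating keeps the bound within the naturals.
theorem3 = 1 , ≤-refl , λ n q m 2≤n _ _ α _ s C comp →
  let instance
        n≢0 : NonZero n
        n≢0 = >-nonZero (≤-trans (s≤s z≤n) 2≤n)
      L , 2^L≤n , n<2^1+L = binary-scale n
      open ≤-Reasoning
  in begin
  n ^ (q * n)              ≤⟨ ^-monoˡ-≤ (q * n) (<⇒≤ n<2^1+L) ⟩
  (2 ^ suc L) ^ (q * n)    ≡⟨ ^-*-assoc 2 (suc L) (q * n) ⟩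
  2 ^ (suc L * (q * n))    ≤⟨ ^-monoʳ-≤ 2 (begin
    suc L * (q * n)          ≡⟨ +-comm (q * n) (L * (q * n)) ⟩
    L * (q * n) + q * n      ≡⟨ cong₂ _+_ (*-comm L (q * n)) (cong (_* n) (sym (*-identityˡ q))) ⟩
    q * n * L + 1 * q * n    ≤⟨ +-monoˡ-≤ (1 * q * n) (shift-bound α C comp L 2^L≤n) ⟩
    s + 1 * q * n            ∎) ⟩
  2 ^ (s + 1 * q * n)      ∎
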